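{- Let $F$ be a one-dimensional tropical fan in $\mathbb{R}^n$ whose rays span $\mathbb{R}^n$, let $v_i,v_j$ be primitive generators of two rays of $F$, and let $l,h\in(\mathbb{Z}^n)^\vee$ be such that $g_l(v_i,v_j)=g_h(v_i,v_j)$ is a gallery of $F$ (i.e. $g_l(v_i,v_j)\in\mathrm{Gly}(F)$ and $g_h(v_i,v_j)\in\mathrm{Gly}(F)$). Then $l=h$.
   Context: A one-dimensional tropical fan $F$ in $\mathbb{R}^n$ consists of finitely many distinct rays $\mathbb{R}_+v_1,\dots,\mathbb{R}_+v_q$ (and the origin), with $v_i\in\mathbb{Z}^n$ primitive, together with positive integer weights $\omega_1,\dots,\omega_q$ satisfying the balancing condition $\sum_i\omega_iv_i=0$. For $l\in(\mathbb{Z}^n)^\vee$ put $\max(0,l)\cdot F=\sum_i\omega_i\max(0,l(v_i))$. If this equals $1$, the gallery of $F$ over $\max(0,l)$ is the set of rays $\mathbb{R}_+v_i$ of $F$ with $|l(v_i)|=1$. $\mathrm{Gly}(F)$ is the set of all galleries of $F$. The notation $g_l(v_a,v_b)\in\mathrm{Gly}(F)$ means that $\max(0,l)\cdot F=1$, that the gallery over $\max(0,l)$ is $\{\mathbb{R}_+v_a,\mathbb{R}_+v_b\}$, and that $l(v_a)=1$, $l(v_b)=-1$; equivalently, $l(v_a)=1$, $l(v_b)=-1$, $\omega_a=\omega_b=1$ and $l(v_i)=0$ for all $i\ne a,b$. -}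

module Defs where

open import Level using (0ℓ)
open import Algebra.Bundles using (AbelianGroup)
open import Algebra.Bundles.Raw using (RawMonoid)
open import Algebra.Morphism.Structures using (IsGroupHomomorphism)
import Algebra.Construct.Pointwise as Pointwise
import Algebra.Definitions.RawMonoid as RawSum
import Algebra.Properties.CommutativeMonoid.Sum as Sum
open import Data.Nat.Base as ℕ using (ℕ)
import Data.Nat.Properties as ℕ
open import Data.Integer.Base as ℤ using (ℤ; +_; 0ℤ; 1ℤ; -1ℤ)
import Data.Integer.Properties as ℤ
open import Data.Integer.Divisibility using (_∣_)
open import Data.Rational.Base as ℚ using (ℚ; 0ℚ; 1ℚ; ½)
import Data.Rational.Properties as ℚ
open import Data.Rational.Solver using (module +-*-Solver)
open import Data.Fin.Base using (Fin)
open import Data.Vec.Functional using (Vector)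
open import Data.Product.Base using (∃; _×_; _,_)
open import Relation.Binary.PropositionalEquality
open import Relation.Nullary using (¬_)
open import Relation.Unary using (Pred; _≐_; _∪_; ｛_｝)

-- Cauchy reals. Only their additive group, their order and the action of ℤ
-- are needed, because all generators of rays are integer vectors.

record ℝ : Set where
  field
    seq    : ℕ → ℚ
    cauchy : ∀ ε → 0ℚ ℚ.< ε → ∃ λ N → ∀ m n → N ℕ.≤ m → N ℕ.≤ n →
             ℚ.∣ seq m ℚ.- seq n ∣ ℚ.< ε

open ℝ public

infix 4 _≈ᵣ_ _≤ᵣ_
infixl 6 _+ᵣ_
infixl 7 _·ᵣ_

_≈ᵣ_ : ℝ → ℝ → Set
x ≈ᵣ y = ∀ ε → 0ℚ ℚ.< ε → ∃ λ N → ∀ n → N ℕ.≤ n → ℚ.∣ seq x n ℚ.- seq y n ∣ ℚ.< ε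

_≤ᵣ_ : ℝ → ℝ → Set
x ≤ᵣ y = ∀ ε → 0ℚ ℚ.< ε → ∃ λ N → ∀ n → N ℕ.≤ n → seq x n ℚ.< seq y n ℚ.+ ε

0ᵣ : ℝ
0ᵣ = record { seq = λ _ → 0ℚ ; cauchy = λ ε 0<ε → 0 , λ _ _ _ _ → 0<ε }

_+ᵣ_ : ℝ → ℝ → ℝ
seq (x +ᵣ y) n = seq x n ℚ.+ seq y n
cauchy (x +ᵣ y) ε 0<ε
  with cauchy x (½ ℚ.* ε) (ℚ.*-monoʳ-<-pos ½ 0<ε)
     | cauchy y (½ ℚ.* ε) (ℚ.*-monoʳ-<-pos ½ 0<ε)
... | N , x-close | M , y-close = N ℕ.⊔ M , λ m n p q → begin-strict
  ℚ.∣ (seq x m ℚ.+ seq y m) ℚ.- (seq x n ℚ.+ seq y n) ∣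
    ≡⟨ cong ℚ.∣_∣ (rearrange (seq x m) (seq y m) (seq x n) (seq y n)) ⟩
  ℚ.∣ (seq x m ℚ.- seq x n) ℚ.+ (seq y m ℚ.- seq y n) ∣
    ≤⟨ ℚ.∣p+q∣≤∣p∣+∣q∣ (seq x m ℚ.- seq x n) (seq y m ℚ.- seq y n) ⟩
  ℚ.∣ seq x m ℚ.- seq x n ∣ ℚ.+ ℚ.∣ seq y m ℚ.- seq y n ∣
    <⟨ ℚ.+-mono-<
         (x-close m n (ℕ.m⊔n≤o⇒m≤o N M p) (ℕ.m⊔n≤o⇒m≤o N M q))
         (y-close m n (ℕ.m⊔n≤o⇒n≤o N M p) (ℕ.m⊔n≤o⇒n≤o N M q)) ⟩
  ½ ℚ.* ε ℚ.+ ½ ℚ.* ε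
    ≡⟨ ℚ.*-distribʳ-+ ε ½ ½ ⟨
  1ℚ ℚ.* ε
    ≡⟨ ℚ.*-identityˡ ε ⟩
  ε ∎
  where
  open ℚ.≤-Reasoning
  rearrange : ∀ a b c d →
              (a ℚ.+ b) ℚ.- (c ℚ.+ d) ≡ (a ℚ.- c) ℚ.+ (b ℚ.- d)
  rearrange = solve 4 (λ a b c d → (a :+ b) :- (c :+ d) := (a :- c) :+ (b :- d)) refl
    where open +-*-Solver

_·ᵣ_ : ℤ → ℝ → ℝ
seq (z ·ᵣ x) n = z ℚ./ 1 ℚ.* seq x n
cauchy (z ·ᵣ x) ε 0<ε =
  let N , x-close = cauchy x (1/c ℚ.* ε) 0<ε/c
  in N , λ m n p q → let d = seq x m ℚ.- seq x n in begin-strict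
  ℚ.∣ r ℚ.* seq x m ℚ.- r ℚ.* seq x n ∣
    ≡⟨ cong ℚ.∣_∣ (factor r (seq x m) (seq x n)) ⟩
  ℚ.∣ r ℚ.* d ∣
    ≡⟨ ℚ.∣p*q∣≡∣p∣*∣q∣ r d ⟩
  ℚ.∣ r ∣ ℚ.* ℚ.∣ d ∣
    ≤⟨ ℚ.*-monoʳ-≤-nonNeg ℚ.∣ d ∣ {{ℚ.∣-∣-nonNeg d}} ∣r∣≤c ⟩
  c ℚ.* ℚ.∣ d ∣
    <⟨ ℚ.*-monoʳ-<-pos c (x-close m n p q) ⟩
  c ℚ.* (1/c ℚ.* ε)
    ≡⟨ ℚ.*-assoc c 1/c ε ⟨
  c ℚ.* 1/c ℚ.* ε
    ≡⟨ cong (ℚ._* ε) (ℚ.*-inverseʳ c) ⟩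
  1ℚ ℚ.* ε
    ≡⟨ ℚ.*-identityˡ ε ⟩
  ε ∎
  where
  open ℚ.≤-Reasoning
  r c 1/c : ℚ
  r = z ℚ./ 1
  c = ℚ.∣ r ∣ ℚ.+ 1ℚ
  instance
    c-pos : ℚ.Positive c
    c-pos = ℚ.nonNeg+pos⇒pos ℚ.∣ r ∣ {{ℚ.∣-∣-nonNeg r}} 1ℚ
    c-nonZero : ℚ.NonZero c
    c-nonZero = ℚ.pos⇒nonZero c
  1/c = ℚ.1/ c
  0<ε/c : 0ℚ ℚ.< 1/c ℚ.* ε
  0<ε/c = subst (ℚ._< 1/c ℚ.* ε) (ℚ.*-zeroʳ 1/c)
            (ℚ.*-monoʳ-<-pos 1/c {{ℚ.1/pos⇒pos c}} 0<ε)
  ∣r∣≤c : ℚ.∣ r ∣ ℚ.≤ c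
  ∣r∣≤c = subst (ℚ._≤ c) (ℚ.+-identityʳ ℚ.∣ r ∣)
            (ℚ.+-monoʳ-≤ ℚ.∣ r ∣ (ℚ.nonNegative⁻¹ 1ℚ))
  factor : ∀ a b e → a ℚ.* b ℚ.- a ℚ.* e ≡ a ℚ.* (b ℚ.- e)
  factor = solve 3 (λ a b e → a :* b :- a :* e := a :* (b :- e)) refl
    where open +-*-Solver

+ᵣ-rawMonoid : RawMonoid 0ℓ 0ℓ
+ᵣ-rawMonoid = record { _≈_ = _≈ᵣ_ ; _∙_ = _+ᵣ_ ; ε = 0ᵣ }

open RawSum +ᵣ-rawMonoid public using () renaming (sum to sumᵣ)
open Sum ℤ.+-0-commutativeMonoid public using () renaming (sum to sumℤ)

Lattice : ℕ → AbelianGroup 0ℓ 0ℓ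
Lattice n = Pointwise.abelianGroup (Fin n) ℤ.+-0-abelianGroup

record Dual (n : ℕ) : Set where
  field
    ⟦_⟧            : Vector ℤ n → ℤ
    isHomomorphism : IsGroupHomomorphism (AbelianGroup.rawGroup (Lattice n))
                       (AbelianGroup.rawGroup ℤ.+-0-abelianGroup) ⟦_⟧

open Dual public using (⟦_⟧)

infix 4 _≈*_

_≈*_ : ∀ {n} → Dual n → Dual n → Set
l ≈* h = ∀ x → ⟦ l ⟧ x ≡ ⟦ h ⟧ x

-- The zero vector is not primitive: every d divides its coordinates.
Primitive : ∀ {n} → Vector ℤ n → Set
Primitive v = ∀ (d : ℕ) → (∀ k → + d ∣ v k) → d ≡ 1

Ray : ∀ {n} → Vector ℤ n → Pred (Vector ℝ n) 0ℓ
Ray v x = ∃ λ t → 0ᵣ ≤ᵣ t × (∀ k → x k ≈ᵣ v k ·ᵣ t)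

record TropicalFan (n : ℕ) : Set where
  field
    q         : ℕ
    v         : Vector (Vector ℤ n) q
    v-prim    : ∀ i → Primitive (v i)
    distinct  : ∀ i j → i ≢ j → ¬ (Ray (v i) ≐ Ray (v j))
    ω         : Vector ℕ q
    ω-pos     : ∀ i → 0 ℕ.< ω i
    balanced  : ∀ k → sumℤ (λ i → + ω i ℤ.* v i k) ≡ 0ℤ

module _ {n : ℕ} (F : TropicalFan n) where
  open TropicalFan F

  RaysSpan : Set
  RaysSpan = ∀ (x : Vector ℝ n) → ∃ λ (c : Vector ℝ q) →
             ∀ k → x k ≈ᵣ sumᵣ (λ i → v i k ·ᵣ c i)

  -- The intersection number max(0,l)·F.
  degree : Dual n → ℤ
  degree l = sumℤ (λ i → + ω i ℤ.* (0ℤ ℤ.⊔ ⟦ l ⟧ (v i)))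

  -- Rays are pairwise distinct, so a set of rays is given by the set of
  -- their indices.
  Gallery : Dual n → Pred (Fin q) 0ℓ
  Gallery l i = ℤ.∣ ⟦ l ⟧ (v i) ∣ ≡ 1

  -- The assertion g_l(v_a, v_b) ∈ Gly(F).
  record IsGallery (l : Dual n) (a b : Fin q) : Set where
    field
      degree≡1 : degree l ≡ 1ℤ
      rays     : Gallery l ≐ (｛ a ｝ ∪ ｛ b ｝)
      l[a]≡1   : ⟦ l ⟧ (v a) ≡ 1ℤ
      l[b]≡-1  : ⟦ l ⟧ (v b) ≡ -1ℤ

-- A functional l cutting out a gallery over v_a, v_b vanishes on every other
-- generator: max(0,l)·F = 1 is already used up by v_a, so l ≤ 0 elsewhere, and
-- by balancing max(0,-l)·F = 1 as well, so -l ≤ 0 away from v_b. Hence d = l - h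
-- vanishes on all generators. Write the real point with coordinates
-- d(e_1), …, d(e_n) as a combination of the rays. Far enough along the Cauchy
-- sequences this combination has rational coordinates s_k within 1 of d(e_k).
-- Then Σ d(e_k) s_k = 0, while d(e_k) s_k > 0 whenever the integer d(e_k) is
-- nonzero.
module Submission where

open import Defs
open import Data.Nat.Base using (ℕ)
open import Data.Fin.Base using (Fin)

open import Level using (0ℓ)
open import Algebra.Bundles using (CommutativeMonoid; CommutativeRing)
open import Algebra.Morphism.Structures using (module GroupMorphisms)
import Algebra.Properties.CommutativeMonoid.Sum as MonoidSum
import Algebra.Properties.Semiring.Sum as SemiringSum
open import Data.Nat.Base as ℕ using (zero; suc)
import Data.Nat.Properties as ℕ
open import Data.Integer.Base as ℤ using (ℤ; +_; +[1+_]; -[1+_]; 0ℤ; 1ℤ)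
import Data.Integer.Properties as ℤ
import Data.Integer.Solver as ℤSolver
open import Data.Rational.Base as ℚ using (ℚ; 0ℚ; 1ℚ)
import Data.Rational.Properties as ℚ
import Data.Rational.Solver as ℚSolver
open import Data.Rational.Unnormalised.Base as ℚᵘ using (mkℚᵘ; *≡*)
import Data.Rational.Unnormalised.Properties as ℚᵘ
open import Data.Fin.Base using (zero; suc; punchOut)
open import Data.Fin.Properties using () renaming (_≟_ to _≟ᶠ_)
open import Data.Vec.Functional using (Vector; tail; removeAt)
open import Data.Vec.Functional.Properties using (removeAt-punchOut)
open import Data.Product.Base using (∃; _,_)
open import Data.Sum.Base using (inj₁; inj₂)
open import Function.Base using (_∘_)
open import Relation.Binary.Core using (Rel)
open import Relation.Binary.Structures using (IsPreorder)
open import Relation.Binary.PropositionalEquality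
open import Relation.Nullary using (yes; no; contradiction)

module _ (M : CommutativeMonoid 0ℓ 0ℓ) where

  open CommutativeMonoid M using (Carrier; _≈_; _∙_; ε; identityˡ; identityʳ)
    renaming (sym to ≈-sym)
  open MonoidSum M using (sum)

  module _
    (_≤_ : Rel Carrier 0ℓ) (≤-isPreorder : IsPreorder _≈_ _≤_)
    (∙-mono-≤ : ∀ {w x y z} → w ≤ x → y ≤ z → (w ∙ y) ≤ (x ∙ z))
    where

    open IsPreorder ≤-isPreorder using () renaming
      (refl to ≤-refl; reflexive to ≤-reflexive; trans to ≤-trans)

    sum-nonNeg : ∀ {n} (t : Vector Carrier n) → (∀ i → ε ≤ t i) → ε ≤ sum t
    sum-nonNeg {zero}  t 0≤t = ≤-refl
    sum-nonNeg {suc n} t 0≤t =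
      ≤-trans (≤-reflexive (≈-sym (identityˡ ε)))
              (∙-mono-≤ (0≤t zero) (sum-nonNeg (tail t) (0≤t ∘ suc)))

    term≤sum : ∀ {n} (t : Vector Carrier n) → (∀ i → ε ≤ t i) → ∀ i → t i ≤ sum t
    term≤sum t 0≤t zero =
      ≤-trans (≤-reflexive (≈-sym (identityʳ (t zero))))
              (∙-mono-≤ ≤-refl (sum-nonNeg (tail t) (0≤t ∘ suc)))
    term≤sum t 0≤t (suc i) =
      ≤-trans (term≤sum (tail t) (0≤t ∘ suc) i)
              (≤-trans (≤-reflexive (≈-sym (identityˡ _)))
                       (∙-mono-≤ (0≤t zero) ≤-refl))

module Σℤ = SemiringSum (CommutativeRing.semiring ℤ.+-*-commutativeRing)
module Σℚ = SemiringSum (CommutativeRing.semiring ℚ.+-*-commutativeRing)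

open Σℚ using () renaming (sum to sumℚ)

sum-exhausted : ∀ {n} (t : Vector ℤ n) → (∀ i → 0ℤ ℤ.≤ t i) → sumℤ t ≡ 1ℤ →
                ∀ {i k} → 1ℤ ℤ.≤ t i → i ≢ k → t k ℤ.≤ 0ℤ
sum-exhausted {suc n} t 0≤t ∑t≡1 {i} {k} 1≤tᵢ i≢k =
  subst (ℤ._≤ 0ℤ) (ℤ.pred-suc (t k)) (ℤ.pred-mono (begin
  ℤ.suc (t k)                    ≡⟨ cong ℤ.suc (removeAt-punchOut t i≢k) ⟨
  1ℤ ℤ.+ t′ (punchOut i≢k)       ≤⟨ ℤ.+-mono-≤ 1≤tᵢ
                                      (term≤sum ℤ.+-0-commutativeMonoid ℤ._≤_
                                        ℤ.≤-isPreorder ℤ.+-mono-≤ t′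
                                        (λ _ → 0≤t _) (punchOut i≢k)) ⟩
  t i ℤ.+ sumℤ t′                ≡⟨ Σℤ.sum-remove {i = i} t ⟨
  sumℤ t                         ≡⟨ ∑t≡1 ⟩
  1ℤ                             ∎))
  where
  open ℤ.≤-Reasoning
  t′ = removeAt t i

0⊔i≡i+0⊔-i : ∀ i → 0ℤ ℤ.⊔ i ≡ i ℤ.+ (0ℤ ℤ.⊔ (ℤ.- i))
0⊔i≡i+0⊔-i (+ zero) = refl
0⊔i≡i+0⊔-i +[1+ n ] = sym (ℤ.+-identityʳ +[1+ n ])
0⊔i≡i+0⊔-i -[1+ n ] = sym (ℤ.+-inverseˡ +[1+ n ])

module _ {q} (ω : Vector ℕ q) (ω-pos : ∀ i → 0 ℕ.< ω i) where

  nonPos-off-support : (a : Vector ℤ q) →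
    sumℤ (λ i → + ω i ℤ.* (0ℤ ℤ.⊔ a i)) ≡ 1ℤ →
    ∀ {i k} → a i ≡ 1ℤ → i ≢ k → a k ℤ.≤ 0ℤ
  nonPos-off-support a deg≡1 {i} {k} aᵢ≡1 i≢k =
    ℤ.≤-trans (ℤ.i≤j⊔i 0ℤ (a k))
      (ℤ.*-cancelˡ-≤-pos (0ℤ ℤ.⊔ a k) 0ℤ (+ ω k) {{ℤ.positive (ℤ.+<+ (ω-pos k))}}
        (subst (t k ℤ.≤_) (sym (ℤ.*-zeroʳ (+ ω k)))
          (sum-exhausted t 0≤t deg≡1 1≤tᵢ i≢k)))
    where
    t : Vector ℤ q
    t j = + ω j ℤ.* (0ℤ ℤ.⊔ a j)
    0≤t : ∀ j → 0ℤ ℤ.≤ t j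
    0≤t j = subst (ℤ._≤ t j) (ℤ.*-zeroʳ (+ ω j))
              (ℤ.*-monoˡ-≤-nonNeg (+ ω j) (ℤ.i≤i⊔j 0ℤ (a j)))
    1≤tᵢ : 1ℤ ℤ.≤ t i
    1≤tᵢ rewrite aᵢ≡1 | ℤ.*-identityʳ (+ ω i) = ℤ.+≤+ (ω-pos i)

  sum-⊔-neg : (a : Vector ℤ q) → sumℤ (λ i → + ω i ℤ.* a i) ≡ 0ℤ →
    sumℤ (λ i → + ω i ℤ.* (0ℤ ℤ.⊔ (ℤ.- a i))) ≡ sumℤ (λ i → + ω i ℤ.* (0ℤ ℤ.⊔ a i))
  sum-⊔-neg a ∑ωa≡0 = begin
    sumℤ a⁻                                ≡⟨ ℤ.+-identityˡ (sumℤ a⁻) ⟨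
    0ℤ ℤ.+ sumℤ a⁻                         ≡⟨ cong (ℤ._+ sumℤ a⁻) ∑ωa≡0 ⟨
    sumℤ (λ i → + ω i ℤ.* a i) ℤ.+ sumℤ a⁻ ≡⟨ Σℤ.∑-distrib-+ (λ i → + ω i ℤ.* a i) a⁻ ⟨
    sumℤ (λ i → + ω i ℤ.* a i ℤ.+ a⁻ i)    ≡⟨ Σℤ.sum-cong-≗ split ⟨
    sumℤ (λ i → + ω i ℤ.* (0ℤ ℤ.⊔ a i))    ∎
    where
    open ≡-Reasoning
    a⁻ : Vector ℤ q
    a⁻ i = + ω i ℤ.* (0ℤ ℤ.⊔ (ℤ.- a i))
    split : ∀ i → + ω i ℤ.* (0ℤ ℤ.⊔ a i) ≡ + ω i ℤ.* a i ℤ.+ a⁻ i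
    split i = trans (cong (+ ω i ℤ.*_) (0⊔i≡i+0⊔-i (a i))) (ℤ.*-distribˡ-+ (+ ω i) _ _)

module _ {n} (l : Dual n) where

  open GroupMorphisms.IsGroupHomomorphism (Dual.isHomomorphism l)

  scale-homo-ℕ : ∀ m x → ⟦ l ⟧ (λ k → + m ℤ.* x k) ≡ + m ℤ.* ⟦ l ⟧ x
  scale-homo-ℕ zero    x = ε-homo
  scale-homo-ℕ (suc m) x = begin
    ⟦ l ⟧ (λ k → +[1+ m ] ℤ.* x k)        ≡⟨ ⟦⟧-cong (λ k → ℤ.suc-* (+ m) (x k)) ⟩
    ⟦ l ⟧ (λ k → x k ℤ.+ + m ℤ.* x k)     ≡⟨ homo x (λ k → + m ℤ.* x k) ⟩
    ⟦ l ⟧ x ℤ.+ ⟦ l ⟧ (λ k → + m ℤ.* x k) ≡⟨ cong (ℤ._+_ (⟦ l ⟧ x)) (scale-homo-ℕ m x) ⟩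
    ⟦ l ⟧ x ℤ.+ + m ℤ.* ⟦ l ⟧ x           ≡⟨ ℤ.suc-* (+ m) (⟦ l ⟧ x) ⟨
    +[1+ m ] ℤ.* ⟦ l ⟧ x                  ∎
    where open ≡-Reasoning

  scale-homo : ∀ z x → ⟦ l ⟧ (λ k → z ℤ.* x k) ≡ z ℤ.* ⟦ l ⟧ x
  scale-homo (+ m)    x = scale-homo-ℕ m x
  scale-homo -[1+ m ] x = begin
    ⟦ l ⟧ (λ k → -[1+ m ] ℤ.* x k)
      ≡⟨ ⟦⟧-cong (λ k → sym (ℤ.neg-distribˡ-* +[1+ m ] (x k))) ⟩
    ⟦ l ⟧ (λ k → ℤ.- (+[1+ m ] ℤ.* x k))  ≡⟨ ⁻¹-homo (λ k → +[1+ m ] ℤ.* x k) ⟩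
    ℤ.- ⟦ l ⟧ (λ k → +[1+ m ] ℤ.* x k)    ≡⟨ cong ℤ.-_ (scale-homo-ℕ (suc m) x) ⟩
    ℤ.- (+[1+ m ] ℤ.* ⟦ l ⟧ x)            ≡⟨ ℤ.neg-distribˡ-* +[1+ m ] (⟦ l ⟧ x) ⟩
    -[1+ m ] ℤ.* ⟦ l ⟧ x                  ∎
    where open ≡-Reasoning

  sum-homo : ∀ {m} (X : Vector (Vector ℤ n) m) →
             ⟦ l ⟧ (λ k → sumℤ (λ i → X i k)) ≡ sumℤ (λ i → ⟦ l ⟧ (X i))
  sum-homo {zero}  X = ε-homo
  sum-homo {suc m} X =
    trans (homo (X zero) _) (cong (ℤ._+_ (⟦ l ⟧ (X zero))) (sum-homo (tail X)))

  linear : ∀ {m} (z : Vector ℤ m) (X : Vector (Vector ℤ n) m) →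
           ⟦ l ⟧ (λ k → sumℤ (λ i → z i ℤ.* X i k)) ≡ sumℤ (λ i → z i ℤ.* ⟦ l ⟧ (X i))
  linear z X = trans (sum-homo (λ i k → z i ℤ.* X i k))
                     (Σℤ.sum-cong-≗ (λ i → scale-homo (z i) (X i)))

unit : ∀ {n} → Fin n → Vector ℤ n
unit zero    zero    = 1ℤ
unit zero    (suc j) = 0ℤ
unit (suc k) zero    = 0ℤ
unit (suc k) (suc j) = unit k j

sum-*-zero : ∀ {n} (x : Vector ℤ n) → sumℤ (λ k → x k ℤ.* 0ℤ) ≡ 0ℤ
sum-*-zero {n} x =
  trans (Σℤ.sum-cong-≗ (λ k → ℤ.*-zeroʳ (x k))) (Σℤ.sum-replicate-zero n)

sum-*-unit : ∀ {n} (x : Vector ℤ n) j → sumℤ (λ k → x k ℤ.* unit k j) ≡ x j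
sum-*-unit x zero =
  trans (cong₂ ℤ._+_ (ℤ.*-identityʳ (x zero)) (sum-*-zero (tail x)))
        (ℤ.+-identityʳ (x zero))
sum-*-unit x (suc j) =
  trans (cong₂ ℤ._+_ (ℤ.*-zeroʳ (x zero)) (sum-*-unit (tail x) j))
        (ℤ.+-identityˡ (x (suc j)))

coordinates : ∀ {n} (l : Dual n) x → ⟦ l ⟧ x ≡ sumℤ (λ k → x k ℤ.* ⟦ l ⟧ (unit k))
coordinates l x = trans (⟦⟧-cong (λ j → sym (sum-*-unit x j))) (linear l x unit)
  where open GroupMorphisms.IsGroupHomomorphism (Dual.isHomomorphism l)

infixl 6 _-*_

_-*_ : ∀ {n} → Dual n → Dual n → Dual n
⟦ l -* h ⟧ x = ⟦ l ⟧ x ℤ.- ⟦ h ⟧ x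
Dual.isHomomorphism (l -* h) = record
  { isMonoidHomomorphism = record
    { isMagmaHomomorphism = record
      { isRelHomomorphism = record
        { cong = λ x≗y → cong₂ ℤ._-_ (L.⟦⟧-cong x≗y) (H.⟦⟧-cong x≗y) }
      ; homo = λ x y → trans (cong₂ ℤ._-_ (L.homo x y) (H.homo x y))
                             (interchange (⟦ l ⟧ x) (⟦ l ⟧ y) (⟦ h ⟧ x) (⟦ h ⟧ y))
      }
    ; ε-homo = cong₂ ℤ._-_ L.ε-homo H.ε-homo
    }
  ; ⁻¹-homo = λ x → trans (cong₂ ℤ._-_ (L.⁻¹-homo x) (H.⁻¹-homo x))
                          (sym (ℤ.neg-distrib-+ (⟦ l ⟧ x) (ℤ.- ⟦ h ⟧ x)))
  }
  where
  module L = GroupMorphisms.IsGroupHomomorphism (Dual.isHomomorphism l)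
  module H = GroupMorphisms.IsGroupHomomorphism (Dual.isHomomorphism h)
  interchange : ∀ a b c d → (a ℤ.+ b) ℤ.- (c ℤ.+ d) ≡ (a ℤ.- c) ℤ.+ (b ℤ.- d)
  interchange = solve 4 (λ a b c d → (a :+ b) :- (c :+ d) := (a :- c) :+ (b :- d)) refl
    where open ℤSolver.+-*-Solver

fromℤ : ℤ → ℚ
fromℤ z = z ℚ./ 1

toℚᵘ-fromℤ : ∀ z → ℚ.toℚᵘ (fromℤ z) ℚᵘ.≃ mkℚᵘ z 0
toℚᵘ-fromℤ z = ℚ.toℚᵘ-fromℚᵘ (mkℚᵘ z 0)

fromℤ-+ : ∀ a b → fromℤ (a ℤ.+ b) ≡ fromℤ a ℚ.+ fromℤ b
fromℤ-+ a b = ℚ.toℚᵘ-injective (begin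
  ℚ.toℚᵘ (fromℤ (a ℤ.+ b))                   ≈⟨ toℚᵘ-fromℤ (a ℤ.+ b) ⟩
  mkℚᵘ (a ℤ.+ b) 0
    ≈⟨ *≡* (cong (ℤ._* 1ℤ) (cong₂ ℤ._+_ (ℤ.*-identityʳ a) (ℤ.*-identityʳ b))) ⟨
  mkℚᵘ a 0 ℚᵘ.+ mkℚᵘ b 0                     ≈⟨ ℚᵘ.+-cong (toℚᵘ-fromℤ a) (toℚᵘ-fromℤ b) ⟨
  ℚ.toℚᵘ (fromℤ a) ℚᵘ.+ ℚ.toℚᵘ (fromℤ b)     ≈⟨ ℚ.toℚᵘ-homo-+ (fromℤ a) (fromℤ b) ⟨
  ℚ.toℚᵘ (fromℤ a ℚ.+ fromℤ b)               ∎)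
  where open import Relation.Binary.Reasoning.Setoid ℚᵘ.≃-setoid

fromℤ-* : ∀ a b → fromℤ (a ℤ.* b) ≡ fromℤ a ℚ.* fromℤ b
fromℤ-* a b = ℚ.toℚᵘ-injective (begin
  ℚ.toℚᵘ (fromℤ (a ℤ.* b))                   ≈⟨ toℚᵘ-fromℤ (a ℤ.* b) ⟩
  mkℚᵘ a 0 ℚᵘ.* mkℚᵘ b 0                     ≈⟨ ℚᵘ.*-cong (toℚᵘ-fromℤ a) (toℚᵘ-fromℤ b) ⟨
  ℚ.toℚᵘ (fromℤ a) ℚᵘ.* ℚ.toℚᵘ (fromℤ b)     ≈⟨ ℚ.toℚᵘ-homo-* (fromℤ a) (fromℤ b) ⟨
  ℚ.toℚᵘ (fromℤ a ℚ.* fromℤ b)               ∎)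
  where open import Relation.Binary.Reasoning.Setoid ℚᵘ.≃-setoid

fromℤ-sum-* : ∀ {n} (a b : Vector ℤ n) →
  sumℚ (λ k → fromℤ (a k) ℚ.* fromℤ (b k)) ≡ fromℤ (sumℤ (λ k → a k ℤ.* b k))
fromℤ-sum-* {zero}  a b = refl
fromℤ-sum-* {suc n} a b = sym (trans
  (fromℤ-+ (a zero ℤ.* b zero) _)
  (cong₂ ℚ._+_ (fromℤ-* (a zero) (b zero)) (sym (fromℤ-sum-* (tail a) (tail b)))))

1≤fromℤ-suc : ∀ m → 1ℚ ℚ.≤ fromℤ +[1+ m ]
1≤fromℤ-suc m = begin
  1ℚ                  ≡⟨ ℚ.+-identityʳ 1ℚ ⟨
  1ℚ ℚ.+ 0ℚ           ≤⟨ ℚ.+-monoʳ-≤ 1ℚ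
                           (ℚ.nonNegative⁻¹ (fromℤ (+ m)) {{ℚ.normalize-nonNeg m 1}}) ⟩
  1ℚ ℚ.+ fromℤ (+ m)  ≡⟨ fromℤ-+ 1ℤ (+ m) ⟨
  fromℤ +[1+ m ]      ∎
  where open ℚ.≤-Reasoning

p≤∣p∣ : ∀ p → p ℚ.≤ ℚ.∣ p ∣
p≤∣p∣ p with ℚ.≤-total 0ℚ p
... | inj₁ 0≤p = ℚ.≤-reflexive (sym (ℚ.0≤p⇒∣p∣≡p 0≤p))
... | inj₂ p≤0 = ℚ.≤-trans p≤0 (ℚ.0≤∣p∣ p)

close-to-suc⇒pos : ∀ m s → ℚ.∣ fromℤ +[1+ m ] ℚ.- s ∣ ℚ.< 1ℚ → 0ℚ ℚ.< s
close-to-suc⇒pos m s close = begin-strict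
  0ℚ                       ≡⟨ ℚ.+-inverseʳ (b ℚ.- s) ⟨
  (b ℚ.- s) ℚ.- (b ℚ.- s)  <⟨ ℚ.+-monoˡ-< (ℚ.- (b ℚ.- s)) b-s<b ⟩
  b ℚ.- (b ℚ.- s)          ≡⟨ solve 2 (λ x y → x :- (x :- y) := y) refl b s ⟩
  s                        ∎
  where
  open ℚ.≤-Reasoning
  open ℚSolver.+-*-Solver
  b = fromℤ +[1+ m ]
  b-s<b : b ℚ.- s ℚ.< b
  b-s<b = ℚ.≤-<-trans (p≤∣p∣ (b ℚ.- s)) (ℚ.<-≤-trans close (1≤fromℤ-suc m))

0<suc*close : ∀ m s → ℚ.∣ fromℤ +[1+ m ] ℚ.- s ∣ ℚ.< 1ℚ →
              0ℚ ℚ.< fromℤ +[1+ m ] ℚ.* s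
0<suc*close m s close = ℚ.positive⁻¹ (fromℤ +[1+ m ] ℚ.* s)
  {{ℚ.pos*pos⇒pos (fromℤ +[1+ m ]) {{ℚ.normalize-pos (suc m) 1}}
                  s {{ℚ.positive (close-to-suc⇒pos m s close)}}}}

0<neg*close : ∀ m s → ℚ.∣ fromℤ -[1+ m ] ℚ.- s ∣ ℚ.< 1ℚ →
              0ℚ ℚ.< fromℤ -[1+ m ] ℚ.* s
0<neg*close m s close =
  subst (0ℚ ℚ.<_) (solve 2 (λ x y → x :* :- y := :- x :* y) refl b s)
    (0<suc*close m (ℚ.- s)
      (subst (ℚ._< 1ℚ) (trans (sym (ℚ.∣-p∣≡∣p∣ (ℚ.- b ℚ.- s))) (cong ℚ.∣_∣ negate)) close))
  where
  open ℚSolver.+-*-Solver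
  b = fromℤ +[1+ m ]
  negate : ℚ.- (ℚ.- b ℚ.- s) ≡ b ℚ.- (ℚ.- s)
  negate = solve 2 (λ x y → :- (:- x :- y) := x :- (:- y)) refl b s

0≤*close : ∀ z s → ℚ.∣ fromℤ z ℚ.- s ∣ ℚ.< 1ℚ → 0ℚ ℚ.≤ fromℤ z ℚ.* s
0≤*close (+ zero) s close = ℚ.≤-reflexive (sym (ℚ.*-zeroˡ s))
0≤*close +[1+ m ] s close = ℚ.<⇒≤ (0<suc*close m s close)
0≤*close -[1+ m ] s close = ℚ.<⇒≤ (0<neg*close m s close)

*close≤0⇒≡0 : ∀ z s → ℚ.∣ fromℤ z ℚ.- s ∣ ℚ.< 1ℚ → fromℤ z ℚ.* s ℚ.≤ 0ℚ → z ≡ 0ℤ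
*close≤0⇒≡0 (+ zero) s close zs≤0 = refl
*close≤0⇒≡0 +[1+ m ] s close zs≤0 =
  contradiction (ℚ.<-≤-trans (0<suc*close m s close) zs≤0) (ℚ.<-irrefl refl)
*close≤0⇒≡0 -[1+ m ] s close zs≤0 =
  contradiction (ℚ.<-≤-trans (0<neg*close m s close) zs≤0) (ℚ.<-irrefl refl)

module _ {n q} (a : Vector ℤ n) (w : Vector (Vector ℤ n) q)
  (a⊥w : ∀ i → sumℤ (λ k → w i k ℤ.* a k) ≡ 0ℤ)
  where

  orthogonal-to-combinations : (c : Vector ℚ q) →
    sumℚ (λ k → fromℤ (a k) ℚ.* sumℚ (λ i → fromℤ (w i k) ℚ.* c i)) ≡ 0ℚ
  orthogonal-to-combinations c = begin
    sumℚ (λ k → fromℤ (a k) ℚ.* sumℚ (λ i → fromℤ (w i k) ℚ.* c i))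
      ≡⟨ Σℚ.sum-cong-≗ (λ k → Σℚ.*-distribˡ-sum (fromℤ (a k)) (λ i → fromℤ (w i k) ℚ.* c i)) ⟩
    sumℚ (λ k → sumℚ (λ i → fromℤ (a k) ℚ.* (fromℤ (w i k) ℚ.* c i)))
      ≡⟨ Σℚ.∑-comm (λ k i → fromℤ (a k) ℚ.* (fromℤ (w i k) ℚ.* c i)) ⟩
    sumℚ (λ i → sumℚ (λ k → fromℤ (a k) ℚ.* (fromℤ (w i k) ℚ.* c i)))
      ≡⟨ Σℚ.sum-cong-≗ vanishes ⟩
    sumℚ {q} (λ i → 0ℚ)
      ≡⟨ Σℚ.sum-replicate-zero q ⟩
    0ℚ ∎
    where
    open ≡-Reasoning
    vanishes : ∀ i → sumℚ (λ k → fromℤ (a k) ℚ.* (fromℤ (w i k) ℚ.* c i)) ≡ 0ℚ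
    vanishes i = begin
      sumℚ (λ k → fromℤ (a k) ℚ.* (fromℤ (w i k) ℚ.* c i))
        ≡⟨ Σℚ.sum-cong-≗ (λ k → rearrange (fromℤ (a k)) (fromℤ (w i k)) (c i)) ⟩
      sumℚ (λ k → fromℤ (w i k) ℚ.* fromℤ (a k) ℚ.* c i)
        ≡⟨ Σℚ.*-distribʳ-sum (c i) (λ k → fromℤ (w i k) ℚ.* fromℤ (a k)) ⟨
      sumℚ (λ k → fromℤ (w i k) ℚ.* fromℤ (a k)) ℚ.* c i
        ≡⟨ cong (ℚ._* c i) (fromℤ-sum-* (w i) a) ⟩
      fromℤ (sumℤ (λ k → w i k ℤ.* a k)) ℚ.* c i
        ≡⟨ cong (λ z → fromℤ z ℚ.* c i) (a⊥w i) ⟩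
      0ℚ ℚ.* c i
        ≡⟨ ℚ.*-zeroˡ (c i) ⟩
      0ℚ ∎
      where
      rearrange : ∀ x y z → x ℚ.* (y ℚ.* z) ≡ y ℚ.* x ℚ.* z
      rearrange = solve 3 (λ x y z → x :* (y :* z) := y :* x :* z) refl
        where open ℚSolver.+-*-Solver

  close-to-combination⇒≡0 : (c : Vector ℚ q) →
    (∀ k → ℚ.∣ fromℤ (a k) ℚ.- sumℚ (λ i → fromℤ (w i k) ℚ.* c i) ∣ ℚ.< 1ℚ) →
    ∀ k → a k ≡ 0ℤ
  close-to-combination⇒≡0 c close k = *close≤0⇒≡0 (a k) (s k) (close k)
    (subst (fromℤ (a k) ℚ.* s k ℚ.≤_) (orthogonal-to-combinations c)
      (term≤sum ℚ.+-0-commutativeMonoid ℚ._≤_ ℚ.≤-isPreorder ℚ.+-mono-≤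
        (λ k → fromℤ (a k) ℚ.* s k) (λ k → 0≤*close (a k) (s k) (close k)) k))
    where
    s : Vector ℚ n
    s k = sumℚ (λ i → fromℤ (w i k) ℚ.* c i)

eventually-all : ∀ {m} {P : Fin m → ℕ → Set} →
  (∀ k → ∃ λ N → ∀ n → N ℕ.≤ n → P k n) → ∃ λ N → ∀ k → P k N
eventually-all {P = P} ev = let N , p = bound ev in N , λ k → p k N ℕ.≤-refl
  where
  bound : ∀ {m} {P : Fin m → ℕ → Set} → (∀ k → ∃ λ N → ∀ n → N ℕ.≤ n → P k n) →
          ∃ λ N → ∀ k n → N ℕ.≤ n → P k n
  bound {zero}  ev = 0 , λ ()
  bound {suc m} ev =
    let N , p = ev zero
        N′ , p′ = bound (ev ∘ suc)
    in N ℕ.⊔ N′ , λ where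
      zero    n ≤n → p n (ℕ.m⊔n≤o⇒m≤o N N′ ≤n)
      (suc k) n ≤n → p′ k n (ℕ.m⊔n≤o⇒n≤o N N′ ≤n)

const : ℚ → ℝ
seq    (const p) _ = p
cauchy (const p) ε 0<ε = 0 , λ _ _ _ _ → subst (ℚ._< ε) (cong ℚ.∣_∣ (sym (ℚ.+-inverseʳ p))) 0<ε

seq-sum : ∀ {m} (X : Vector ℝ m) N → seq (sumᵣ X) N ≡ sumℚ (λ i → seq (X i) N)
seq-sum {zero}  X N = refl
seq-sum {suc m} X N = cong (seq (X zero) N ℚ.+_) (seq-sum (tail X) N)

module _ {n} (F : TropicalFan n) where
  open TropicalFan F

  vanishes-on-rays⇒≡0 : RaysSpan F → (d : Dual n) → (∀ i → ⟦ d ⟧ (v i) ≡ 0ℤ) →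
                        ∀ x → ⟦ d ⟧ x ≡ 0ℤ
  vanishes-on-rays⇒≡0 span d d[v]≡0 x = begin
    ⟦ d ⟧ x                      ≡⟨ coordinates d x ⟩
    sumℤ (λ k → x k ℤ.* a k)     ≡⟨ Σℤ.sum-cong-≗ (λ k → cong (x k ℤ.*_) (a≡0 k)) ⟩
    sumℤ (λ k → x k ℤ.* 0ℤ)      ≡⟨ sum-*-zero x ⟩
    0ℤ                           ∎
    where
    open ≡-Reasoning
    a : Vector ℤ n
    a k = ⟦ d ⟧ (unit k)
    a≡0 : ∀ k → a k ≡ 0ℤ
    a≡0 =
      let c , a≈∑vc = span (λ k → const (fromℤ (a k)))
          N , close = eventually-all (λ k → a≈∑vc k 1ℚ (ℚ.positive⁻¹ 1ℚ))
      in close-to-combination⇒≡0 a v (λ i → trans (sym (coordinates d (v i))) (d[v]≡0 i))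
           (λ i → seq (c i) N)
           (λ k → subst (λ s → ℚ.∣ fromℤ (a k) ℚ.- s ∣ ℚ.< 1ℚ)
                    (seq-sum (λ i → v i k ·ᵣ c i) N) (close k))

  balanced-dual : (l : Dual n) → sumℤ (λ i → + ω i ℤ.* ⟦ l ⟧ (v i)) ≡ 0ℤ
  balanced-dual l = begin
    sumℤ (λ i → + ω i ℤ.* ⟦ l ⟧ (v i))          ≡⟨ linear l (+_ ∘ ω) v ⟨
    ⟦ l ⟧ (λ k → sumℤ (λ i → + ω i ℤ.* v i k))  ≡⟨ ⟦⟧-cong balanced ⟩
    ⟦ l ⟧ (λ k → 0ℤ)                            ≡⟨ ε-homo ⟩
    0ℤ                                          ∎
    where
    open ≡-Reasoning
    open GroupMorphisms.IsGroupHomomorphism (Dual.isHomomorphism l)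

  gallery⇒≡0 : ∀ {l a b} → IsGallery F l a b → ∀ k → a ≢ k → b ≢ k → ⟦ l ⟧ (v k) ≡ 0ℤ
  gallery⇒≡0 {l} g k a≢k b≢k = ℤ.≤-antisym
    (nonPos-off-support ω ω-pos l[v] degree≡1 l[a]≡1 a≢k)
    (ℤ.neg-cancel-≤
      (nonPos-off-support ω ω-pos (ℤ.-_ ∘ l[v])
        (trans (sum-⊔-neg ω ω-pos l[v] (balanced-dual l)) degree≡1)
        (cong ℤ.-_ l[b]≡-1) b≢k))
    where
    open IsGallery g
    l[v] : Vector ℤ q
    l[v] i = ⟦ l ⟧ (v i)

  gallery-determines-values : ∀ {l h a b} → IsGallery F l a b → IsGallery F h a b →
                              ∀ k → ⟦ l ⟧ (v k) ≡ ⟦ h ⟧ (v k)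
  gallery-determines-values {a = a} {b} gₗ gₕ k with a ≟ᶠ k | b ≟ᶠ k
  ... | yes refl | _        = trans (IsGallery.l[a]≡1 gₗ) (sym (IsGallery.l[a]≡1 gₕ))
  ... | no _     | yes refl = trans (IsGallery.l[b]≡-1 gₗ) (sym (IsGallery.l[b]≡-1 gₕ))
  ... | no a≢k   | no b≢k   =
    trans (gallery⇒≡0 gₗ k a≢k b≢k) (sym (gallery⇒≡0 gₕ k a≢k b≢k))

lemma3p10 : (n : ℕ) (F : TropicalFan n) → RaysSpan F →
    (i j : Fin (TropicalFan.q F)) (l h : Dual n) →
    IsGallery F l i j → IsGallery F h i j → l ≈* h
lemma3p10 n F span i j l h gₗ gₕ x = ℤ.i-j≡0⇒i≡j (⟦ l ⟧ x) (⟦ h ⟧ x)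
  (vanishes-on-rays⇒≡0 F span (l -* h)
    (λ k → ℤ.i≡j⇒i-j≡0 (gallery-determines-values F gₗ gₕ k)) x)
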